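{- Let $\mathcal C$ be a class of graphs such that, for some $n,k\in\mathbb N$, $\mathrm{wd}^\otimes_n(G)\le k$ for all $G\in\mathcal C$. The following statements are equivalent: (1) $\mathcal C$ is $\mathrm{MSO}_1$-orderable. (2) $\mathcal C$ has property $\mathsf{CUT}$. (3) There is a constant $d\in\mathbb N$ such that every $G\in\mathcal C$ has a $\otimes$-decomposition $(H_v)_{v\in T}$ of height at most $n$ and width at most $k$ where every vertex of $T$ has outdegree at most $d$. (4) $\mathcal C$ is finite.
   Context: Graphs are finite, simple, undirected. A graph with ports in $[k]=\{0,\dots,k-1\}$ is a graph $\langle U,F,\pi\rangle$ with $\pi:U\to[k]$. For $R\subseteq[k]\times[k]$ and graphs $G,H$ with ports in $[k]$, $G\otimes_R H$ is the disjoint union of $G,H$ plus all edges $(x,y)$ with $x$ in one of the graphs, $y$ in the other, and the port labels $(a,b)$ of $x,y$ in $R$; $\mathrm{Del}$ deletes port labels. A $\otimes$-decomposition of a graph $G=\langle V,E\rangle$ of width $k$ is a family $(H_v)_{v\in T}$ of graphs $H_v=\langle U_v,F_v,\pi_v\rangle$ with ports in $[k]$, indexed by a rooted tree $T$, such that the root graph is $\langle V,E\rangle$ with some labelling, $|U_v|=1$ for every leaf $v$, and for every internal node $v$ with immediate successors $u_0,\dots,u_{d-1}$ there is $R_v\subseteq[k]\times[k]$ with $\mathrm{Del}(H_v)=\mathrm{Del}(H_{u_0}\otimes_{R_v}\cdots\otimes_{R_v}H_{u_{d-1}})$. Its height is the height of $T$. $\mathrm{wd}^\otimes_n(G)$ is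 the least $k$ such that $G$ has a $\otimes$-decomposition of width at most $k$ and height at most $n$. For a graph $G=\langle V,E\rangle$, $\lfloor G\rfloor=\langle V,\mathrm{edg}\rangle$; $\mathcal C$ is $\mathrm{MSO}_1$-orderable if there is an MSO-formula $\varphi(x,y;\bar Z)$ such that for every nonempty $G\in\mathcal C$ there are sets $\bar P\subseteq V$ with $\{(a,b):\lfloor G\rfloor\models\varphi(a,b;\bar P)\}$ a linear order on $V$. $\mathrm{Cut}(G,k)$ is the maximal $m$ such that there are nonempty graphs $H_0,\dots,H_{m-1}$ with ports in $[k]$ and $R\subseteq[k]\times[k]$ with $G\cong\mathrm{Del}(H_0\otimes_R\cdots\otimes_R H_{m-1})$; $\mathcal C$ has property $\mathsf{CUT}$ if there is $f:\mathbb N\to\mathbb N$ with $\mathrm{Cut}(G,k)\le f(k)$ for all $G\in\mathcal C$, $k\in\mathbb N$. -}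

module Defs where

open import Data.Nat using (ℕ; zero; suc; _≤_; _<_)
open import Data.Fin using (Fin; _≟_)
open import Data.Bool using (Bool; true; false; _∨_)
open import Data.Product using (Σ; _×_; _,_; ∃)
open import Data.Sum using (_⊎_)
open import Data.Empty using (⊥)
open import Relation.Nullary using (¬_; yes; no)
open import Relation.Binary.PropositionalEquality using (_≡_; refl)
open import Relation.Binary.Structures using (IsTotalOrder)
open import Function.Bundles using (_↔_; Inverse)
open import Data.Vec using (Vec; lookup)

record Graph : Set where
  field
    size   : ℕ
    adj    : Fin size → Fin size → Bool
    sym    : ∀ x y → adj x y ≡ adj y x
    irrefl : ∀ x → adj x x ≡ false
open Graph public

_≅_ : Graph → Graph → Set
G ≅ H = Σ (Fin (size G) ↔ Fin (size H)) λ f →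
          ∀ x y → adj G x y ≡ adj H (Inverse.to f x) (Inverse.to f y)

record PGraph (k : ℕ) : Set where
  field
    graph : Graph
    port  : Fin (size graph) → Fin k
open PGraph public

Del : ∀ {k} → PGraph k → Graph
Del = graph

PortRel : ℕ → Set
PortRel k = Fin k → Fin k → Bool

UnionV : ∀ {k m} → (Fin m → PGraph k) → Set
UnionV {m = m} Hs = Σ (Fin m) λ i → Fin (size (graph (Hs i)))

-- Adjacency in Del(Hs 0 ⊗_R ... ⊗_R Hs (m-1)): inside a component the
-- original edges; between distinct components an edge iff the pair of
-- port labels (in one of the two orders) lies in R.
combAdj : ∀ {k m} (R : PortRel k) (Hs : Fin m → PGraph k) →
          UnionV Hs → UnionV Hs → Bool
combAdj R Hs (i , x) (j , y) with i ≟ j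
... | yes refl = adj (graph (Hs i)) x y
... | no _     = R (port (Hs i) x) (port (Hs j) y) ∨ R (port (Hs j) y) (port (Hs i) x)

IsProduct : ∀ {k m} → Graph → PortRel k → (Fin m → PGraph k) → Set
IsProduct G R Hs = Σ (Fin (size G) ↔ UnionV Hs) λ f →
  ∀ x y → adj G x y ≡ combAdj R Hs (Inverse.to f x) (Inverse.to f y)

data Decomp (k : ℕ) : PGraph k → Set where
  leaf : (H : PGraph k) → size (graph H) ≡ 1 → Decomp k H
  node : (H : PGraph k) (d : ℕ) (R : PortRel k) (Hs : Fin (suc d) → PGraph k) →
         (∀ i → Decomp k (Hs i)) → IsProduct (Del H) R Hs → Decomp k H

data HeightLe {k : ℕ} : ℕ → {H : PGraph k} → Decomp k H → Set where
  leafH : ∀ {n H} (p : size (graph H) ≡ 1) → HeightLe n (leaf H p)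
  nodeH : ∀ {n H d R Hs ch p} → (∀ i → HeightLe n (ch i)) →
          HeightLe (suc n) (node H d R Hs ch p)

data OutdegLe {k : ℕ} (D : ℕ) : {H : PGraph k} → Decomp k H → Set where
  leafO : ∀ {H} (p : size (graph H) ≡ 1) → OutdegLe D (leaf H p)
  nodeO : ∀ {H d R Hs ch p} → suc d ≤ D → (∀ i → OutdegLe D (ch i)) →
          OutdegLe D (node H d R Hs ch p)

-- G has a ⊗-decomposition of width ≤ k and height ≤ n, i.e. wd^⊗_n(G) ≤ k
-- (the root graph is G with some port labelling, up to renaming vertices).
WdLe : ℕ → ℕ → Graph → Set
WdLe n k G = Σ (PGraph k) λ H → Σ (Decomp k H) λ D → HeightLe n D × (Del H ≅ G)

WdLeDeg : ℕ → ℕ → ℕ → Graph → Set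
WdLeDeg n k d G = Σ (PGraph k) λ H → Σ (Decomp k H) λ D →
  HeightLe n D × OutdegLe d D × (Del H ≅ G)

-- Monadic second-order logic over ⌊G⌋ = ⟨V, edg⟩ (MSO₁):
-- i first-order (vertex) variables, j set variables (de Bruijn).

data Formula : ℕ → ℕ → Set where
  edg  : ∀ {i j} → Fin i → Fin i → Formula i j
  eq   : ∀ {i j} → Fin i → Fin i → Formula i j
  mem  : ∀ {i j} → Fin i → Fin j → Formula i j
  neg  : ∀ {i j} → Formula i j → Formula i j
  and  : ∀ {i j} → Formula i j → Formula i j → Formula i j
  or   : ∀ {i j} → Formula i j → Formula i j → Formula i j
  ex₁  : ∀ {i j} → Formula (suc i) j → Formula i j
  ex₂  : ∀ {i j} → Formula i (suc j) → Formula i j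

Sat : (G : Graph) → ∀ {i j} → (Fin i → Fin (size G)) →
      (Fin j → Fin (size G) → Bool) → Formula i j → Set
Sat G ρ σ (edg a b) = adj G (ρ a) (ρ b) ≡ true
Sat G ρ σ (eq a b)  = ρ a ≡ ρ b
Sat G ρ σ (mem a Z) = σ Z (ρ a) ≡ true
Sat G ρ σ (neg φ)   = ¬ Sat G ρ σ φ
Sat G ρ σ (and φ ψ) = Sat G ρ σ φ × Sat G ρ σ ψ
Sat G ρ σ (or φ ψ)  = Sat G ρ σ φ ⊎ Sat G ρ σ ψ
Sat G ρ σ (ex₁ φ)   = Σ (Fin (size G)) λ v → Sat G (extend ρ v) σ φ
  where
    extend : ∀ {i} {A : Set} → (Fin i → A) → A → Fin (suc i) → A
    extend ρ v Fin.zero    = v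
    extend ρ v (Fin.suc a) = ρ a
Sat G ρ σ (ex₂ φ)   = Σ (Fin (size G) → Bool) λ P → Sat G ρ (extend σ P) φ
  where
    extend : ∀ {j} {A : Set} → (Fin j → A) → A → Fin (suc j) → A
    extend σ P Fin.zero    = P
    extend σ P (Fin.suc a) = σ a

pair : ∀ {A : Set} → A → A → Fin 2 → A
pair a b Fin.zero       = a
pair a b (Fin.suc _)    = b

MSO1Orderable : (Graph → Set) → Set
MSO1Orderable C = Σ ℕ λ j → Σ (Formula 2 j) λ φ →
  ∀ G → C G → 0 < size G →
  Σ (Fin j → Fin (size G) → Bool) λ P →
    IsTotalOrder _≡_ (λ a b → Sat G (pair a b) P φ)

CutLe : Graph → ℕ → ℕ → Set
CutLe G k b = ∀ m (R : PortRel k) (Hs : Fin m → PGraph k) →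
  (∀ i → 0 < size (graph (Hs i))) → IsProduct G R Hs → m ≤ b

HasCUT : (Graph → Set) → Set
HasCUT C = Σ (ℕ → ℕ) λ f → ∀ G → C G → ∀ k → CutLe G k (f k)

BoundedOutdeg : ℕ → ℕ → (Graph → Set) → Set
BoundedOutdeg n k C = Σ ℕ λ d → ∀ G → C G → WdLeDeg n k d G

FiniteClass : (Graph → Set) → Set
FiniteClass C = Σ ℕ λ m → Σ (Fin m → Graph) λ Gs →
  ∀ G → C G → Σ (Fin m) λ i → G ≅ Gs i

{-# OPTIONS --safe #-}

-- Each condition is equivalent to a bound on the size of the graphs in the
-- class; a bound is obtained by induction on the height of a decomposition.
--
-- CUT: a cut of a factor into parts extends to a cut of the whole product with
-- equally many parts and boundedly more labels, so CUT descends along the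
-- decomposition while it bounds the arity of every node.
--
-- Orderability: satisfaction is invariant under automorphisms preserving the
-- parameters, so a graph with a definable order has no nontrivial
-- automorphism fixing the colouring given by the parameters. This rigidity
-- descends to the factors, coloured also by their ports. A node with more
-- factors than there are small coloured graphs has two isomorphic ones, and
-- swapping these is a nontrivial automorphism.
module Submission where

open import Defs
open import Data.Nat using (ℕ; zero; suc; _+_; _*_; _^_; _≤_; _<_; z≤n; s≤s; _⊔_)
import Data.Nat.Properties as ℕ
open import Data.Fin using (Fin; zero; suc; _≟_; toℕ; fromℕ<; inject≤; combine; remQuot; funToFin; finToFun)
import Data.Fin.Properties as Fin
open import Data.Bool using (Bool; true; false; _∨_; _∧_; not)
import Data.Bool.Properties as Bool
open import Data.Product using (Σ; _×_; _,_; ∃; proj₁; proj₂)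
open import Data.Product.Properties using (,-injectiveˡ)
open import Data.Sum using (_⊎_; inj₁; inj₂)
open import Data.Sum.Function.Propositional using (_⊎-↔_)
open import Data.List using (List; length; lookup; tabulate; concatMap; upTo)
open import Data.List.Relation.Unary.Any using (Any; index)
open import Data.List.Relation.Unary.Any.Properties using (lookup-index; concatMap⁺; applyUpTo⁺; tabulate⁺)
open import Function using (_∘_; id)
open import Function.Bundles using (_⇔_; _↔_; Inverse; Injection; mk⇔; mk↔ₛ′)
open import Function.Construct.Composition using (_⇔-∘_)
open import Function.Construct.Symmetry using (⇔-sym)
open import Function.Definitions using (Injective)
open import Function.Properties.Inverse using (↔-refl; ↔-sym; ↔-trans; ↔⇒↣)
open import Relation.Binary.PropositionalEquality using (_≡_; _≢_; refl; cong; cong₂; subst; trans; module ≡-Reasoning)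
import Relation.Binary.PropositionalEquality as ≡
open import Relation.Binary.Structures using (IsTotalOrder)
open import Relation.Nullary using (¬_; yes; no; contradiction)
open import Relation.Nullary.Decidable using (⌊_⌋)

open Inverse using (to; from; strictlyInverseˡ; strictlyInverseʳ)

private variable
  k K m b : ℕ

to-injective : {A B : Set} (f : A ↔ B) {x y : A} → to f x ≡ to f y → x ≡ y
to-injective f = Injection.injective (↔⇒↣ f)

≅-sym : ∀ G H → G ≅ H → H ≅ G
≅-sym G H (f , f-adj) = ↔-sym f , λ x y →
  ≡.sym (trans (f-adj (from f x) (from f y))
               (cong₂ (adj H) (strictlyInverseˡ f x) (strictlyInverseˡ f y)))

-- Products

portU : (Hs : Fin m → PGraph k) → UnionV Hs → Fin k
portU Hs (i , x) = port (Hs i) x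

combAdj-same : (R : PortRel k) (Hs : Fin m → PGraph k) → ∀ i x y →
  combAdj R Hs (i , x) (i , y) ≡ adj (graph (Hs i)) x y
combAdj-same R Hs i x y with i ≟ i
... | yes refl = refl
... | no i≢i   = contradiction refl i≢i

combAdj-diff : (R : PortRel k) (Hs : Fin m → PGraph k) → ∀ u v → proj₁ u ≢ proj₁ v →
  combAdj R Hs u v ≡ R (portU Hs u) (portU Hs v) ∨ R (portU Hs v) (portU Hs u)
combAdj-diff R Hs (i , x) (j , y) i≢j with i ≟ j
... | yes i≡j = contradiction i≡j i≢j
... | no _    = refl

arity≤size : ∀ G {R : PortRel k} {Hs : Fin m → PGraph k} →
  (∀ i → 0 < size (graph (Hs i))) → IsProduct G R Hs → m ≤ size G
arity≤size G nonempty (f , _) =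
  Fin.injective⇒≤ {f = λ i → from f (i , fromℕ< (nonempty i))}
    λ eqn → ,-injectiveˡ (to-injective (↔-sym f) eqn)

factor≤size : ∀ G {R : PortRel k} {Hs : Fin m → PGraph k} →
  IsProduct G R Hs → ∀ i → size (graph (Hs i)) ≤ size G
factor≤size G {Hs = Hs} (f , _) i =
  Fin.injective⇒≤ {f = λ x → from f (i , x)} λ eqn → second (to-injective (↔-sym f) eqn)
  where
  second : ∀ {x y} → _≡_ {A = UnionV Hs} (i , x) (i , y) → x ≡ y
  second refl = refl

size≤arity*factor : ∀ G {R : PortRel k} {Hs : Fin m → PGraph k} →
  (∀ i → size (graph (Hs i)) ≤ b) → IsProduct G R Hs → size G ≤ m * b
size≤arity*factor {m = m} {b = b} G {Hs = Hs} factor≤b (f , _) =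
  Fin.injective⇒≤ {f = code ∘ to f} (to-injective f ∘ code-injective _ _)
  where
  code : UnionV Hs → Fin (m * b)
  code (i , x) = combine i (inject≤ x (factor≤b i))
  code-injective : ∀ u v → code u ≡ code v → u ≡ v
  code-injective (i , x) (j , y) eqn with Fin.combine-injective i _ j _ eqn
  ... | refl , eqn′ = cong (i ,_) (Fin.inject≤-injective (factor≤b i) (factor≤b i) x y eqn′)

-- Leaves are singletons and every node has a successor, so the factors in a decomposition always
-- form an admissible cut.
decomp-nonempty : {H : PGraph k} → Decomp k H → 0 < size (Del H)
decomp-nonempty (leaf H p) = subst (0 <_) (≡.sym p) (s≤s z≤n)
decomp-nonempty (node H d R Hs ch p) =
  ℕ.≤-trans (s≤s z≤n) (arity≤size (Del H) (decomp-nonempty ∘ ch) p)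

-- Nonempty factors cannot outnumber the vertices of their product, and none is larger than it; so
-- any decomposition of a small graph serves unchanged.
outdeg≤size : {H : PGraph k} (D : Decomp k H) → size (Del H) ≤ b → OutdegLe b D
outdeg≤size (leaf H p) _ = leafO p
outdeg≤size (node H d R Hs ch p) H≤b =
  nodeO (ℕ.≤-trans (arity≤size (Del H) (decomp-nonempty ∘ ch) p) H≤b)
        λ i → outdeg≤size (ch i) (ℕ.≤-trans (factor≤size (Del H) p i) H≤b)

-- Leaves may occur at every height, also when `d` is 0; the successor leaves room for their single
-- vertex.
degreeBound : ℕ → ℕ → ℕ
degreeBound d zero    = 1
degreeBound d (suc h) = suc (d * degreeBound d h)

leaf≤ : ∀ {s} → s ≡ 1 → s ≤ suc b
leaf≤ refl = s≤s z≤n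

size≤degreeBound : ∀ {d h} {H : PGraph k} {D : Decomp k H} →
  HeightLe h D → OutdegLe d D → size (Del H) ≤ degreeBound d h
size≤degreeBound {h = zero}  (leafH p) _ = leaf≤ p
size≤degreeBound {h = suc _} (leafH p) _ = leaf≤ p
size≤degreeBound {H = H} (nodeH {p = p} hs) (nodeO deg os) =
  ℕ.m≤n⇒m≤1+n (ℕ.≤-trans (size≤arity*factor (Del H) (λ i → size≤degreeBound (hs i) (os i)) p)
                          (ℕ.*-monoˡ-≤ _ deg))

-- Property CUT

-- Graphs have vertex sets `Fin s`, so turning a part of a cut into a graph requires an injective
-- enumeration of it.
fibre : ∀ {n} (c : Fin n → Fin m) (i : Fin m) →
  Σ ℕ λ s → Σ (Fin s → Fin n) λ e →
    Injective _≡_ _≡_ e × (∀ t → c (e t) ≡ i) × (∀ x → c x ≡ i → ∃ λ t → e t ≡ x)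
fibre {n = zero} c i = 0 , (λ ()) , (λ { {()} }) , (λ ()) , λ ()
fibre {n = suc n} c i with fibre (c ∘ suc) i
... | s , e , inj , e-fib , e-all with c zero ≟ i
...   | yes c0≡i = suc s , e′ , inj′ , fib′ , all′
  where
  e′ : Fin (suc s) → Fin (suc n)
  e′ zero    = zero
  e′ (suc t) = suc (e t)
  inj′ : Injective _≡_ _≡_ e′
  inj′ {zero}  {zero}  _  = refl
  inj′ {suc _} {suc _} eqn = cong suc (inj (Fin.suc-injective eqn))
  fib′ : ∀ t → c (e′ t) ≡ i
  fib′ zero    = c0≡i
  fib′ (suc t) = e-fib t
  all′ : ∀ x → c x ≡ i → ∃ λ t → e′ t ≡ x
  all′ zero    _  = zero , refl
  all′ (suc x) eqn with e-all x eqn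
  ... | t , refl = suc t , refl
...   | no c0≢i = s , suc ∘ e , inj ∘ Fin.suc-injective , e-fib , all′
  where
  all′ : ∀ x → c x ≡ i → ∃ λ t → suc (e t) ≡ x
  all′ zero    eqn = contradiction eqn c0≢i
  all′ (suc x) eqn with e-all x eqn
  ... | t , refl = t , refl

-- A product decomposition of G seen from the vertices of G.
record Cut (G : Graph) (m : ℕ) (L : Set) : Set where
  field
    part      : Fin (size G) → Fin m
    part-onto : ∀ i → ∃ λ x → part x ≡ i
    label     : Fin (size G) → L
    rel       : L → L → Bool
    separated : ∀ x y → part x ≢ part y → adj G x y ≡ rel (label x) (label y)

product⇒cut : ∀ G {R : PortRel K} {Hs : Fin m → PGraph K} →
  (∀ i → 0 < size (graph (Hs i))) → IsProduct G R Hs → Cut G m (Fin K)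
product⇒cut G {R} {Hs} nonempty (f , f-adj) = record
  { part      = proj₁ ∘ to f
  ; part-onto = λ i → from f (i , fromℕ< (nonempty i)) , cong proj₁ (strictlyInverseˡ f _)
  ; label     = portU Hs ∘ to f
  ; rel       = λ a b → R a b ∨ R b a
  ; separated = λ x y ne → trans (f-adj x y) (combAdj-diff R Hs (to f x) (to f y) ne)
  }

-- Converse of `product⇒cut`: the factors are the induced subgraphs on the parts, with the labels,
-- numbered through `lab`, as ports.
module CutProduct {G : Graph} {L : Set} (lab : Fin K ↔ L) (C : Cut G m L) where
  open Cut C

  V : Set
  V = Fin (size G)

  R : PortRel K
  R a b = rel (to lab a) (to lab b)

  e : ∀ i → Fin (proj₁ (fibre part i)) → V
  e i = proj₁ (proj₂ (fibre part i))

  e-injective : ∀ i → Injective _≡_ _≡_ (e i)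
  e-injective i = proj₁ (proj₂ (proj₂ (fibre part i)))

  part-e : ∀ i t → part (e i t) ≡ i
  part-e i = proj₁ (proj₂ (proj₂ (proj₂ (fibre part i))))

  e-onto : ∀ i x → part x ≡ i → ∃ λ t → e i t ≡ x
  e-onto i = proj₂ (proj₂ (proj₂ (proj₂ (fibre part i))))

  Hs : Fin m → PGraph K
  Hs i = record
    { graph = record
      { size   = proj₁ (fibre part i)
      ; adj    = λ t u → adj G (e i t) (e i u)
      ; sym    = λ t u → sym G (e i t) (e i u)
      ; irrefl = λ t → irrefl G (e i t)
      }
    ; port = λ t → from lab (label (e i t))
    }

  nonempty : ∀ i → 0 < size (graph (Hs i))
  nonempty i with part-onto i
  ... | x , eqn with e-onto i x eqn
  ...   | t , _ = ℕ.≤-trans (s≤s z≤n) (Fin.toℕ<n t)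

  glue : UnionV Hs → V
  glue (i , t) = e i t

  glue-injective : ∀ u v → glue u ≡ glue v → u ≡ v
  glue-injective (i , t) (j , u) eqn
    with refl ← trans (≡.sym (part-e i t)) (trans (cong part eqn) (part-e j u)) =
    cong (i ,_) (e-injective i eqn)

  split : V → UnionV Hs
  split x = part x , proj₁ (e-onto (part x) x refl)

  glue-split : ∀ x → glue (split x) ≡ x
  glue-split x = proj₂ (e-onto (part x) x refl)

  adj-glue : ∀ u v → adj G (glue u) (glue v) ≡ combAdj R Hs u v
  adj-glue (i , t) (j , u) with i ≟ j
  ... | yes refl = refl
  -- `combAdj` takes a disjunction over both orders of the ports. `rel` need not be symmetric, but
  -- on the labels of vertices in distinct parts both orders return the same adjacency.
  ... | no i≢j   = begin
    adj G (e i t) (e j u)     ≡⟨ Bool.∨-idem _ ⟨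
    adj G (e i t) (e j u) ∨ adj G (e i t) (e j u)
      ≡⟨ cong₂ _∨_ (edge i≢j) (trans (sym G _ _) (edge (i≢j ∘ ≡.sym))) ⟩
    R (port (Hs i) t) (port (Hs j) u) ∨ R (port (Hs j) u) (port (Hs i) t) ∎
    where
    open ≡-Reasoning
    edge : ∀ {i j t u} → i ≢ j → adj G (e i t) (e j u) ≡ R (port (Hs i) t) (port (Hs j) u)
    edge {i} {j} {t} {u} i≢j = trans
      (separated _ _ λ eqn → i≢j (trans (≡.sym (part-e i t)) (trans eqn (part-e j u))))
      (≡.sym (cong₂ rel (strictlyInverseˡ lab _) (strictlyInverseˡ lab _)))

  product : IsProduct G R Hs
  product =
      mk↔ₛ′ split glue (λ u → glue-injective _ _ (glue-split (glue u))) glue-split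
    , λ x y → trans (cong₂ (adj G) (≡.sym (glue-split x)) (≡.sym (glue-split y)))
                    (adj-glue (split x) (split y))

cut-arity : ∀ {G} {L : Set} → CutLe G K b → Fin K ↔ L → Cut G m L → m ≤ b
cut-arity {m = m} G-cut lab C = G-cut m R Hs nonempty product
  where open CutProduct lab C

-- The rest of the product joins the part of some vertex x₀ of the factor, so
-- that the cut keeps its number of parts.
module LiftCut {R : PortRel k} {Hs : Fin m → PGraph k} (i : Fin m) {n K : ℕ}
  (C : Cut (graph (Hs i)) n (Fin K)) (x₀ : Fin (size (graph (Hs i)))) where
  open Cut C

  partU : UnionV Hs → Fin n
  partU (l , y) with l ≟ i
  ... | yes refl = part y
  ... | no _     = part x₀

  -- The old port is kept beside the new label, as it determines the edges between this factor and
  -- the others.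
  Label : Set
  Label = (Fin K × Fin k) ⊎ Fin k

  labelU : UnionV Hs → Label
  labelU (l , y) with l ≟ i
  ... | yes refl = inj₁ (label y , port (Hs i) y)
  ... | no _     = inj₂ (port (Hs l) y)

  relU : Label → Label → Bool
  relU (inj₁ (a , _)) (inj₁ (b , _)) = rel a b
  relU (inj₁ (_ , p)) (inj₂ q)       = R p q ∨ R q p
  relU (inj₂ p)       (inj₁ (_ , q)) = R p q ∨ R q p
  -- An arbitrary value: vertices outside the factor all lie in the part of `x₀`, so no two of them
  -- are separated.
  relU (inj₂ _)       (inj₂ _)       = false

  separatedU : ∀ u v → partU u ≢ partU v → combAdj R Hs u v ≡ relU (labelU u) (labelU v)
  separatedU (l , x) (r , y) ne with l ≟ i | r ≟ i
  ... | yes refl | yes refl = trans (combAdj-same R Hs i x y) (separated x y ne)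
  ... | yes refl | no r≢i   = combAdj-diff R Hs (i , x) (r , y) (r≢i ∘ ≡.sym)
  ... | no l≢i   | yes refl = combAdj-diff R Hs (l , x) (i , y) l≢i
  ... | no _     | no _     = contradiction refl ne

  partU-factor : ∀ x → partU (i , x) ≡ part x
  partU-factor x with i ≟ i
  ... | yes refl = refl
  ... | no i≢i   = contradiction refl i≢i

  lift : ∀ G → IsProduct G R Hs → Cut G n Label
  lift G (f , f-adj) = record
    { part      = partU ∘ to f
    ; part-onto = λ c → let x , eqn = part-onto c in
        from f (i , x) , trans (cong partU (strictlyInverseˡ f _)) (trans (partU-factor x) eqn)
    ; label     = labelU ∘ to f
    ; rel       = relU
    ; separated = λ x y ne → trans (f-adj x y) (separatedU (to f x) (to f y) ne)
    }

-- The lifted cut has labels in `Label`, which has `K * k + k` elements.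
cut-factor : ∀ G {R : PortRel k} {Hs : Fin m → PGraph k} → IsProduct G R Hs →
  CutLe G (K * k + k) b → ∀ i → CutLe (graph (Hs i)) K b
-- With no parts there is no vertex to serve as `x₀`.
cut-factor G p G-cut i zero    S Js nonempty q = z≤n
cut-factor {k = k} {K = K} G {R} {Hs} p G-cut i (suc n) S Js nonempty q =
  cut-arity G-cut labels (LiftCut.lift {R = R} {Hs = Hs} i C (proj₁ (Cut.part-onto C zero)) G p)
  where
  C : Cut (graph (Hs i)) (suc n) (Fin K)
  C = product⇒cut (graph (Hs i)) nonempty q
  labels : Fin (K * k + k) ↔ ((Fin K × Fin k) ⊎ Fin k)
  labels = ↔-trans Fin.+↔⊎ (Fin.*↔× ⊎-↔ ↔-refl)

-- `f` bounds the cuts of the current graph for each number of labels. Its value at `k` bounds the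
-- arity, and passing to a factor replaces its values by those at `K * k + k`.
cutBound : ℕ → (ℕ → ℕ) → ℕ → ℕ
cutBound k f zero    = 1
cutBound k f (suc h) = suc (f k * cutBound k (λ K → f (K * k + k)) h)

size≤cutBound : ∀ {h f} {H : PGraph k} {D : Decomp k H} → HeightLe h D →
  (∀ K → CutLe (Del H) K (f K)) → size (Del H) ≤ cutBound k f h
size≤cutBound {h = zero}  (leafH p) _ = leaf≤ p
size≤cutBound {h = suc _} (leafH p) _ = leaf≤ p
size≤cutBound {k = k} {H = H} (nodeH {d = d} {R} {Hs} {ch} {p} hs) H-cut =
  ℕ.m≤n⇒m≤1+n (ℕ.≤-trans
    (size≤arity*factor (Del H)
      (λ i → size≤cutBound (hs i) λ K → cut-factor (Del H) p (H-cut (K * k + k)) i) p)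
    (ℕ.*-monoˡ-≤ _ (H-cut k (suc d) R Hs (decomp-nonempty ∘ ch) p)))

-- Orderability

-- Involutions suffice for the swaps below, and unlike general automorphisms
-- they carry their own inverse.
record Involution {V A : Set} (E : V → V → Bool) (χ : V → A) : Set where
  field
    act        : V → V
    involutive : ∀ x → act (act x) ≡ x
    act-adj    : ∀ x y → E (act x) (act y) ≡ E x y
    act-colour : ∀ x → χ (act x) ≡ χ x
open Involution

Rigid : {V A : Set} (E : V → V → Bool) (χ : V → A) → Set
Rigid E χ = (t : Involution E χ) → ∀ x → act t x ≡ x

rigid-transport : {V W A : Set} {E : V → V → Bool} {F : W → W → Bool} {χ : V → A}
  (f : V ↔ W) → (∀ x y → E x y ≡ F (to f x) (to f y)) → Rigid E χ → Rigid F (χ ∘ from f)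
rigid-transport {E = E} {F} {χ} f f-adj rigid t w =
  to-injective (↔-sym f) (trans (cong (from f ∘ act t) (≡.sym (strictlyInverseˡ f w)))
                                (rigid conjugate (from f w)))
  where
  conjugate : Involution E χ
  conjugate .act = from f ∘ act t ∘ to f
  conjugate .involutive x = trans
    (cong (from f) (trans (cong (act t) (strictlyInverseˡ f _)) (involutive t (to f x))))
    (strictlyInverseʳ f x)
  conjugate .act-adj x y = begin
    E (from f (act t (to f x))) (from f (act t (to f y)))   ≡⟨ f-adj _ _ ⟩
    F (to f (from f (act t (to f x)))) (to f (from f (act t (to f y))))
      ≡⟨ cong₂ F (strictlyInverseˡ f _) (strictlyInverseˡ f _) ⟩
    F (act t (to f x)) (act t (to f y))                     ≡⟨ act-adj t _ _ ⟩
    F (to f x) (to f y)                                     ≡⟨ f-adj x y ⟨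
    E x y                                                   ∎
    where open ≡-Reasoning
  conjugate .act-colour x =
    trans (act-colour t (to f x)) (cong χ (strictlyInverseʳ f x))

module _ {R : PortRel k} {Hs : Fin m → PGraph k} {A : Set} {χ : UnionV Hs → A} where

  -- `T` maps factors into factors and, being its own inverse, cannot merge two of them. Between
  -- distinct factors adjacency depends only on ports, which `T` preserves.
  union-involution : (T : UnionV Hs → UnionV Hs) → (∀ u → T (T u) ≡ u) →
    (∀ u → χ (T u) ≡ χ u) → (∀ u → portU Hs (T u) ≡ portU Hs u) →
    (∀ i x y → proj₁ (T (i , x)) ≡ proj₁ (T (i , y)) ×
               combAdj R Hs (T (i , x)) (T (i , y)) ≡ adj (graph (Hs i)) x y) →
    Involution (combAdj R Hs) χ
  union-involution T T-inv T-colour T-port T-factor = record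
    { act = T ; involutive = T-inv ; act-adj = T-adj ; act-colour = T-colour }
    where
    T-same : ∀ u v → proj₁ u ≡ proj₁ v → proj₁ (T u) ≡ proj₁ (T v)
    T-same (i , x) (.i , y) refl = proj₁ (T-factor i x y)

    T-diff : ∀ u v → proj₁ u ≢ proj₁ v → proj₁ (T u) ≢ proj₁ (T v)
    T-diff u v ne eqn = ne
      (trans (cong proj₁ (≡.sym (T-inv u)))
             (trans (T-same (T u) (T v) eqn) (cong proj₁ (T-inv v))))

    T-adj : ∀ u v → combAdj R Hs (T u) (T v) ≡ combAdj R Hs u v
    T-adj (i , x) (j , y) with i ≟ j
    ... | yes refl = proj₂ (T-factor i x y)
    ... | no i≢j   = trans (combAdj-diff R Hs (T (i , x)) (T (j , y)) (T-diff _ _ i≢j))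
      (cong₂ (λ p q → R p q ∨ R q p) (T-port (i , x)) (T-port (j , y)))

-- Port and colour are fused into one colour, so that isomorphisms of coloured factors respect the
-- edges to the rest of the product.
colouredFactor : (Hs : Fin m → PGraph k) (χ : UnionV Hs → Fin K) → Fin m → PGraph (K * k)
colouredFactor Hs χ i = record
  { graph = graph (Hs i) ; port = λ x → combine (χ (i , x)) (port (Hs i) x) }

module _ (Hs : Fin m → PGraph k) (χ : UnionV Hs → Fin K) {i j x y}
  (same : port (colouredFactor Hs χ i) x ≡ port (colouredFactor Hs χ j) y) where

  combine-χ : χ (i , x) ≡ χ (j , y)
  combine-χ = Fin.combine-injectiveˡ _ _ _ _ same

  combine-port : port (Hs i) x ≡ port (Hs j) y
  combine-port = Fin.combine-injectiveʳ (χ (i , x)) _ (χ (j , y)) _ same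

-- An involution of one factor extends by the identity on all others.
factor-rigid : {R : PortRel k} {Hs : Fin m → PGraph k} {χ : UnionV Hs → Fin K} →
  Rigid (combAdj R Hs) χ →
  ∀ i → Rigid (adj (graph (Hs i))) (port (colouredFactor Hs χ i))
factor-rigid {R = R} {Hs} {χ} rigid i t x = second (trans (≡.sym (T-at x)) (rigid extension (i , x)))
  where
  T : UnionV Hs → UnionV Hs
  T (l , y) with l ≟ i
  ... | yes refl = l , act t y
  ... | no _     = l , y

  T-at : ∀ y → T (i , y) ≡ (i , act t y)
  T-at y with i ≟ i
  ... | yes refl = refl
  ... | no i≢i   = contradiction refl i≢i

  T-inv : ∀ u → T (T u) ≡ u
  T-inv (l , y) with l ≟ i in eqn
  ... | yes refl = trans (T-at _) (cong (i ,_) (involutive t y))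
  ... | no l≢i rewrite eqn = refl

  T-colour : ∀ u → χ (T u) ≡ χ u
  T-colour (l , y) with l ≟ i
  ... | yes refl = combine-χ Hs χ (act-colour t y)
  ... | no _     = refl

  T-port : ∀ u → portU Hs (T u) ≡ portU Hs u
  T-port (l , y) with l ≟ i
  ... | yes refl = combine-port Hs χ (act-colour t y)
  ... | no _     = refl

  T-factor : ∀ l y z → proj₁ (T (l , y)) ≡ proj₁ (T (l , z)) ×
    combAdj R Hs (T (l , y)) (T (l , z)) ≡ adj (graph (Hs l)) y z
  T-factor l y z with l ≟ i
  ... | yes refl = refl , trans (combAdj-same R Hs l _ _) (act-adj t y z)
  ... | no _     = refl , combAdj-same R Hs l y z

  extension : Involution (combAdj R Hs) χ
  extension = union-involution T T-inv T-colour T-port T-factor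

  second : ∀ {y z} → _≡_ {A = UnionV Hs} (i , y) (i , z) → y ≡ z
  second refl = refl

_≅ᶜ_ : PGraph K → PGraph K → Set
P ≅ᶜ Q = Σ (Fin (size (graph P)) ↔ Fin (size (graph Q))) λ f →
  (∀ x y → adj (graph P) x y ≡ adj (graph Q) (to f x) (to f y)) ×
  (∀ x → port P x ≡ port Q (to f x))

≅ᶜ-common : (P Q S : PGraph K) → P ≅ᶜ S → Q ≅ᶜ S → P ≅ᶜ Q
≅ᶜ-common P Q S (f , f-adj , f-port) (g , g-adj , g-port) =
    ↔-trans f (↔-sym g)
  , (λ x y → trans (f-adj x y) (≡.sym (trans (g-adj _ _)
      (cong₂ (adj (graph S)) (strictlyInverseˡ g _) (strictlyInverseˡ g _)))))
  , λ x → trans (f-port x) (≡.sym (trans (g-port _) (cong (port S) (strictlyInverseˡ g _))))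

-- Exchanging the factors `i` and `j` along an isomorphism would be an involution of the product
-- that moves the vertices of factor `i`.
factors-distinct : {R : PortRel k} {Hs : Fin m → PGraph k} {χ : UnionV Hs → Fin K} →
  Rigid (combAdj R Hs) χ → ∀ {i j} → i ≢ j → 0 < size (graph (Hs i)) →
  ¬ (colouredFactor Hs χ i ≅ᶜ colouredFactor Hs χ j)
factors-distinct {R = R} {Hs} {χ} rigid {i} {j} i≢j nonempty (f , f-adj , f-port) =
  i≢j (cong proj₁ (trans (≡.sym (rigid swap (i , x₀))) (T-i x₀)))
  where
  x₀ : Fin (size (graph (Hs i)))
  x₀ = fromℕ< nonempty

  T : UnionV Hs → UnionV Hs
  T (l , y) with l ≟ i | l ≟ j
  ... | yes refl | _        = j , to f y
  ... | no _     | yes refl = i , from f y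
  ... | no _     | no _     = l , y

  T-i : ∀ y → T (i , y) ≡ (j , to f y)
  T-i y with i ≟ i | i ≟ j
  ... | yes refl | _ = refl
  ... | no i≢i   | _ = contradiction refl i≢i

  T-j : ∀ y → T (j , y) ≡ (i , from f y)
  T-j y with j ≟ i | j ≟ j
  ... | yes j≡i | _        = contradiction (≡.sym j≡i) i≢j
  ... | no _    | yes refl = refl
  ... | no _    | no j≢j   = contradiction refl j≢j

  T-inv : ∀ u → T (T u) ≡ u
  T-inv (l , y) with l ≟ i in eqn | l ≟ j in eqn′
  ... | yes refl | _        = trans (T-j _) (cong (i ,_) (strictlyInverseʳ f y))
  ... | no _     | yes refl = trans (T-i _) (cong (j ,_) (strictlyInverseˡ f y))
  ... | no _     | no _     rewrite eqn | eqn′ = refl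

  f-port⁻¹ : ∀ y → port (colouredFactor Hs χ i) (from f y) ≡ port (colouredFactor Hs χ j) y
  f-port⁻¹ y = trans (f-port _) (cong (port (colouredFactor Hs χ j)) (strictlyInverseˡ f y))

  T-colour : ∀ u → χ (T u) ≡ χ u
  T-colour (l , y) with l ≟ i | l ≟ j
  ... | yes refl | _        = ≡.sym (combine-χ Hs χ (f-port y))
  ... | no _     | yes refl = combine-χ Hs χ (f-port⁻¹ y)
  ... | no _     | no _     = refl

  T-port : ∀ u → portU Hs (T u) ≡ portU Hs u
  T-port (l , y) with l ≟ i | l ≟ j
  ... | yes refl | _        = ≡.sym (combine-port Hs χ (f-port y))
  ... | no _     | yes refl = combine-port Hs χ (f-port⁻¹ y)
  ... | no _     | no _     = refl

  T-factor : ∀ l y z → proj₁ (T (l , y)) ≡ proj₁ (T (l , z)) ×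
    combAdj R Hs (T (l , y)) (T (l , z)) ≡ adj (graph (Hs l)) y z
  T-factor l y z with l ≟ i | l ≟ j
  ... | yes refl | _        = refl , trans (combAdj-same R Hs j _ _) (≡.sym (f-adj y z))
  ... | no _     | yes refl = refl , trans (combAdj-same R Hs i _ _) (trans (f-adj _ _)
          (cong₂ (adj (graph (Hs j))) (strictlyInverseˡ f y) (strictlyInverseˡ f z)))
  ... | no _     | no _     = refl , combAdj-same R Hs l y z

  swap : Involution (combAdj R Hs) χ
  swap = union-involution T T-inv T-colour T-port T-factor

-- Enumeration of small coloured graphs

-- Symmetrising and removing loops turns any Boolean table into a graph, so every code can be
-- decoded.
simple : (s : ℕ) → (Fin s → Fin s → Bool) → Graph
simple s E = record
  { size   = s
  ; adj    = λ x y → not ⌊ x ≟ y ⌋ ∧ (E x y ∨ E y x)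
  ; sym    = symmetric
  ; irrefl = irreflexive
  }
  where
  symmetric : ∀ x y → not ⌊ x ≟ y ⌋ ∧ (E x y ∨ E y x) ≡ not ⌊ y ≟ x ⌋ ∧ (E y x ∨ E x y)
  symmetric x y with x ≟ y | y ≟ x
  ... | yes _   | yes _   = refl
  ... | yes x≡y | no y≢x  = contradiction (≡.sym x≡y) y≢x
  ... | no x≢y  | yes y≡x = contradiction (≡.sym y≡x) x≢y
  ... | no _    | no _    = Bool.∨-comm (E x y) (E y x)
  irreflexive : ∀ x → not ⌊ x ≟ x ⌋ ∧ (E x x ∨ E x x) ≡ false
  irreflexive x with x ≟ x
  ... | yes _  = refl
  ... | no x≢x = contradiction refl x≢x

adj-simple : ∀ G (E : Fin (size G) → Fin (size G) → Bool) → (∀ x y → E x y ≡ adj G x y) →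
  ∀ x y → adj G x y ≡ adj (simple (size G) E) x y
adj-simple G E E≗adj x y with x ≟ y
... | yes refl = irrefl G x
... | no _     = ≡.sym (trans (cong₂ _∨_ (E≗adj x y) (trans (E≗adj y x) (sym G y x)))
                              (Bool.∨-idem _))

-- An entry of the s × s table records adjacency together with the colour of
-- the row, so the colours are read off the diagonal.
decode : ∀ s → Fin (((2 * K) ^ s) ^ s) → PGraph K
decode {K} s t = record { graph = simple s E ; port = λ x → proj₂ (entry x x) }
  where
  entry : Fin s → Fin s → Fin 2 × Fin K
  entry x y = remQuot K (finToFun (finToFun {n = s} t x) y)
  E : Fin s → Fin s → Bool
  E x y = to Fin.2↔Bool (proj₁ (entry x y))

encode : (P : PGraph K) → Fin (((2 * K) ^ size (graph P)) ^ size (graph P))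
encode P = funToFin λ x → funToFin λ y →
  combine (from Fin.2↔Bool (adj (graph P) x y)) (port P x)

≅ᶜ-decode : (P : PGraph K) → P ≅ᶜ decode (size (graph P)) (encode P)
≅ᶜ-decode {K} P = ↔-refl , adj-simple (graph P) _ E≡ , λ x → ≡.sym (cong proj₂ (entry≡ x x))
  where
  s : ℕ
  s = size (graph P)
  entry≡ : ∀ x y → remQuot {2} K (finToFun (finToFun {n = s} (encode P) x) y) ≡
                   (from Fin.2↔Bool (adj (graph P) x y) , port P x)
  entry≡ x y = trans
    (cong (remQuot K) (trans (cong (λ t → finToFun t y) (Fin.finToFun-funToFin _ x))
                             (Fin.finToFun-funToFin _ y)))
    (Fin.remQuot-combine {2} _ _)
  E≡ : ∀ x y → to Fin.2↔Bool (proj₁ (remQuot {2} K (finToFun (finToFun {n = s} (encode P) x) y)))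
             ≡ adj (graph P) x y
  E≡ x y = trans (cong (to Fin.2↔Bool ∘ proj₁) (entry≡ x y)) (strictlyInverseˡ Fin.2↔Bool _)

-- The position of a copy in this list is the finite invariant used in the pigeonhole argument and,
-- with one colour, in the proof of finiteness.
smallGraphs : ∀ K → ℕ → List (PGraph K)
smallGraphs K b = concatMap (λ s → tabulate (decode s)) (upTo (suc b))

smallGraphs-complete : (P : PGraph K) → size (graph P) ≤ b → Any (P ≅ᶜ_) (smallGraphs K b)
smallGraphs-complete P P≤b =
  concatMap⁺ (λ s → tabulate (decode s))
    (applyUpTo⁺ id (tabulate⁺ {f = decode (size (graph P))} (encode P) (≅ᶜ-decode P)) (s≤s P≤b))

-- Size bound for rigid graphs

-- With more factors than list entries, two factors are isomorphic to the same entry, contrary to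
-- `factors-distinct`.
rigid-arity : {R : PortRel k} {Hs : Fin m → PGraph k} {χ : UnionV Hs → Fin K} →
  Rigid (combAdj R Hs) χ → (∀ i → 0 < size (graph (Hs i))) →
  (∀ i → size (graph (Hs i)) ≤ b) → m ≤ length (smallGraphs (K * k) b)
rigid-arity {k = k} {m = m} {K = K} {b = b} {Hs = Hs} {χ} rigid nonempty Hs≤b =
  ℕ.≮⇒≥ λ few → let i , j , i<j , same = Fin.pigeonhole few (index ∘ code) in
    factors-distinct rigid (Fin.<⇒≢ i<j) (nonempty i)
      (≅ᶜ-common (P i) (P j) (lookup (smallGraphs (K * k) b) (index (code i)))
        (lookup-index (code i))
        (subst (λ c → P j ≅ᶜ lookup (smallGraphs (K * k) b) c) (≡.sym same)
               (lookup-index (code j))))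
  where
  P : Fin m → PGraph (K * k)
  P = colouredFactor Hs χ
  code : ∀ i → Any (P i ≅ᶜ_) (smallGraphs (K * k) b)
  code i = smallGraphs-complete (P i) (Hs≤b i)

-- `K` becomes `K * k` because a factor absorbs its ports into the colouring. The size of the
-- factors is bounded first; the list of candidates up to that size then bounds the arity.
rigidBound : ℕ → ℕ → ℕ → ℕ
rigidBound k K zero    = 1
rigidBound k K (suc h) =
  suc (length (smallGraphs (K * k) (rigidBound k (K * k) h)) * rigidBound k (K * k) h)

size≤rigidBound : ∀ {h} {H : PGraph k} {D : Decomp k H} → HeightLe h D →
  (χ : Fin (size (Del H)) → Fin K) → Rigid (adj (Del H)) χ → size (Del H) ≤ rigidBound k K h
size≤rigidBound {h = zero}  (leafH p) _ _ = leaf≤ p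
size≤rigidBound {h = suc _} (leafH p) _ _ = leaf≤ p
size≤rigidBound {k = k} {K = K} {h = suc h} {H = H}
                (nodeH {d = d} {R} {Hs} {ch} {p@(f , f-adj)} hs) χ rigid =
  ℕ.m≤n⇒m≤1+n (ℕ.≤-trans (size≤arity*factor (Del H) factor≤ p)
    (ℕ.*-monoˡ-≤ _ (rigid-arity rigidU (decomp-nonempty ∘ ch) factor≤)))
  where
  rigidU : Rigid (combAdj R Hs) (χ ∘ from f)
  rigidU = rigid-transport f f-adj rigid
  factor≤ : ∀ i → size (graph (Hs i)) ≤ rigidBound k (K * k) h
  factor≤ i = size≤rigidBound (hs i) _ (factor-rigid rigidU i)

-- Invariance of satisfaction

module _ {G : Graph} {A : Set} {χ : Fin (size G) → A} (t : Involution (adj G) χ) where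

  -- The assignments are related pointwise, because extending an assignment commutes with `act t`
  -- only pointwise.
  sat-act : ∀ {i j} (φ : Formula i j) {ρ ρ′ : Fin i → Fin (size G)}
    {σ σ′ : Fin j → Fin (size G) → Bool} →
    (∀ a → ρ′ a ≡ act t (ρ a)) → (∀ Z x → σ′ Z (act t x) ≡ σ Z x) →
    Sat G ρ σ φ → Sat G ρ′ σ′ φ
  sat-act (edg a b) hρ hσ s = trans (cong₂ (adj G) (hρ a) (hρ b)) (trans (act-adj t _ _) s)
  sat-act (eq a b)  hρ hσ s = trans (hρ a) (trans (cong (act t) s) (≡.sym (hρ b)))
  sat-act (mem a Z) {σ′ = σ′} hρ hσ s = trans (cong (σ′ Z) (hρ a)) (trans (hσ Z _) s)
  -- Negation asks for the converse implication. It is the same statement with the two assignments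
  -- exchanged, as `t` is its own inverse.
  sat-act (neg φ) {ρ} {ρ′} {σ} {σ′} hρ hσ s s′ = s (sat-act φ
    (λ a → trans (≡.sym (involutive t (ρ a))) (cong (act t) (≡.sym (hρ a))))
    (λ Z x → trans (≡.sym (hσ Z (act t x))) (cong (σ′ Z) (involutive t x))) s′)
  sat-act (and φ ψ) hρ hσ (s , s′) = sat-act φ hρ hσ s , sat-act ψ hρ hσ s′
  sat-act (or φ ψ)  hρ hσ (inj₁ s) = inj₁ (sat-act φ hρ hσ s)
  sat-act (or φ ψ)  hρ hσ (inj₂ s) = inj₂ (sat-act ψ hρ hσ s)
  sat-act (ex₁ φ)   hρ hσ (v , s)  =
    act t v , sat-act φ (λ { zero → refl ; (suc a) → hρ a }) hσ s
  -- Since `t` is an involution, the image of `P` is its preimage.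
  sat-act (ex₂ φ)   hρ hσ (P , s)  = P ∘ act t ,
    sat-act φ hρ (λ { zero x → cong P (involutive t x) ; (suc Z) x → hσ Z x }) s

bits : ∀ {j} → (Fin j → Bool) → Fin (2 ^ j)
bits β = funToFin (from Fin.2↔Bool ∘ β)

bits-injective : ∀ {j} {β γ : Fin j → Bool} → bits β ≡ bits γ → ∀ Z → β Z ≡ γ Z
bits-injective {β = β} {γ} eqn Z = to-injective (↔-sym Fin.2↔Bool) (begin
  from Fin.2↔Bool (β Z)    ≡⟨ Fin.finToFun-funToFin _ Z ⟨
  finToFun (bits β) Z      ≡⟨ cong (λ c → finToFun c Z) eqn ⟩
  finToFun (bits γ) Z      ≡⟨ Fin.finToFun-funToFin _ Z ⟩
  from Fin.2↔Bool (γ Z)    ∎)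
  where open ≡-Reasoning

-- `t` exchanges `a` and `act t a` and preserves the parameters, so `φ` relates the two in both
-- directions as soon as in one; totality and antisymmetry make them equal.
order⇒rigid : ∀ G {j} (φ : Formula 2 j) (P : Fin j → Fin (size G) → Bool) →
  IsTotalOrder _≡_ (λ a b → Sat G (pair a b) P φ) →
  Rigid (adj G) (λ x → bits (λ Z → P Z x))
order⇒rigid G φ P order t a with IsTotalOrder.total order (act t a) a
... | inj₁ ta≤a = IsTotalOrder.antisym order ta≤a
  (sat-act t φ (λ { zero → ≡.sym (involutive t a) ; (suc _) → refl })
     (λ Z x → bits-injective (act-colour t x) Z) ta≤a)
... | inj₂ a≤ta = IsTotalOrder.antisym order
  (sat-act t φ (λ { zero → refl ; (suc _) → ≡.sym (involutive t a) })
     (λ Z x → bits-injective (act-colour t x) Z) a≤ta) a≤ta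

-- A definable order on graphs of bounded size

conj : ∀ {j} N → (Fin N → Formula 2 j) → Formula 2 j
-- The empty conjunction, expressed by a valid equation.
conj zero    φ = eq zero zero
conj (suc N) φ = and (φ zero) (conj N (φ ∘ suc))

module _ {G : Graph} {j : ℕ} {ρ : Fin 2 → Fin (size G)} {σ : Fin j → Fin (size G) → Bool} where

  conj⁺ : ∀ N {φ : Fin N → Formula 2 j} → (∀ Z → Sat G ρ σ (φ Z)) → Sat G ρ σ (conj N φ)
  conj⁺ zero    s = refl
  conj⁺ (suc N) s = s zero , conj⁺ N (s ∘ suc)

  conj⁻ : ∀ N {φ : Fin N → Formula 2 j} → Sat G ρ σ (conj N φ) → ∀ Z → Sat G ρ σ (φ Z)
  conj⁻ (suc N) (s , _) zero    = s
  conj⁻ (suc N) (_ , s) (suc Z) = conj⁻ N s Z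

-- With the parameters P_Z = {v : v ≤ Z}, this says that every P_Z containing
-- the second variable contains the first.
initialSegments : ∀ N → Formula 2 N
initialSegments N = conj N λ Z → neg (and (mem (suc zero) Z) (neg (mem zero Z)))

module _ (G : Graph) {N : ℕ} (G≤N : size G ≤ N) where

  -- Indices beyond the last vertex give the full set, so graphs of different sizes all receive `N`
  -- parameters.
  segment : Fin N → Fin (size G) → Bool
  segment Z v = ⌊ toℕ v ℕ.≤? toℕ Z ⌋

  segment⁺ : ∀ Z v → toℕ v ≤ toℕ Z → segment Z v ≡ true
  segment⁺ Z v v≤Z with toℕ v ℕ.≤? toℕ Z
  ... | yes _  = refl
  ... | no v≰Z = contradiction v≤Z v≰Z

  segment⁻ : ∀ Z v → segment Z v ≡ true → toℕ v ≤ toℕ Z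
  segment⁻ Z v s with toℕ v ℕ.≤? toℕ Z
  ... | yes v≤Z = v≤Z

  _≼_ : Fin (size G) → Fin (size G) → Set
  a ≼ b = Sat G (pair a b) segment (initialSegments N)

  ≼⁺ : ∀ {a b} → toℕ a ≤ toℕ b → a ≼ b
  ≼⁺ {a} {b} a≤b = conj⁺ {G} N λ Z (b∈Z , a∉Z) →
    a∉Z (segment⁺ Z a (ℕ.≤-trans a≤b (segment⁻ Z b b∈Z)))

  ≼⁻ : ∀ {a b} → a ≼ b → toℕ a ≤ toℕ b
  -- If `b` precedes `a`, the segment ending at `b` contains `b` but not `a`.
  ≼⁻ {a} {b} a≼b = ℕ.≮⇒≥ λ b<a → conj⁻ {G} N a≼b Z
      ( segment⁺ Z b (ℕ.≤-reflexive (≡.sym Z≡b))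
      , λ a∈Z → ℕ.<⇒≱ b<a (ℕ.≤-trans (segment⁻ Z a a∈Z) (ℕ.≤-reflexive Z≡b)))
    where
    Z : Fin N
    Z = inject≤ b G≤N
    Z≡b : toℕ Z ≡ toℕ b
    Z≡b = Fin.toℕ-inject≤ b G≤N

  ≼-isTotalOrder : IsTotalOrder _≡_ _≼_
  ≼-isTotalOrder = record
    { isPartialOrder = record
      { isPreorder = record
        { isEquivalence = ≡.isEquivalence
        ; reflexive     = λ { refl → ≼⁺ ℕ.≤-refl }
        ; trans         = λ a≼b b≼c → ≼⁺ (ℕ.≤-trans (≼⁻ a≼b) (≼⁻ b≼c))
        }
      ; antisym = λ a≼b b≼a → Fin.toℕ-injective (ℕ.≤-antisym (≼⁻ a≼b) (≼⁻ b≼a))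
      }
    ; total = total
    }
    where
    total : ∀ a b → a ≼ b ⊎ b ≼ a
    total a b with ℕ.≤-total (toℕ a) (toℕ b)
    ... | inj₁ a≤b = inj₁ (≼⁺ a≤b)
    ... | inj₂ b≤a = inj₂ (≼⁺ b≤a)

-- Bounded size

BoundedSize : (Graph → Set) → Set
BoundedSize C = Σ ℕ λ N → ∀ G → C G → size G ≤ N

≅⇒≤ : ∀ G H → G ≅ H → size G ≤ size H
≅⇒≤ G H (f , _) = Fin.injective⇒≤ (to-injective f)

upperBound : ∀ {m} (s : Fin m → ℕ) → Σ ℕ λ N → ∀ i → s i ≤ N
upperBound {zero}  s = 0 , λ ()
upperBound {suc m} s with upperBound (s ∘ suc)
... | N , s≤N = s zero ⊔ N , λ
  { zero    → ℕ.m≤m⊔n _ _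
  ; (suc i) → ℕ.≤-trans (s≤N i) (ℕ.m≤n⊔m _ _) }

finite⇔bounded : (C : Graph → Set) → FiniteClass C ⇔ BoundedSize C
finite⇔bounded C = mk⇔ bounded finite
  where
  bounded : FiniteClass C → BoundedSize C
  bounded (m , Gs , C-finite) with upperBound (size ∘ Gs)
  ... | N , Gs≤N = N , λ G G∈C → let i , G≅Gi = C-finite G G∈C in
    ℕ.≤-trans (≅⇒≤ G (Gs i) G≅Gi) (Gs≤N i)
  finite : BoundedSize C → FiniteClass C
  finite (N , C≤N) = length (smallGraphs 1 N) , graph ∘ lookup (smallGraphs 1 N) , λ G G∈C →
    -- A single colour makes coloured isomorphism plain isomorphism.
    let any = smallGraphs-complete (record { graph = G ; port = λ _ → zero }) (C≤N G G∈C)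
        f , f-adj , _ = lookup-index any
    in index any , f , f-adj

cutLe-≅ : ∀ G H → G ≅ H → CutLe G K b → CutLe H K b
cutLe-≅ G H (f , f-adj) G-cut m R Hs nonempty (g , g-adj) =
  G-cut m R Hs nonempty (↔-trans f g , λ x y → trans (f-adj x y) (g-adj (to f x) (to f y)))

-- Equivalences with bounded size

module _ (C : Graph → Set) (n k : ℕ) (C-wd : ∀ G → C G → WdLe n k G) where

  cut⇔bounded : HasCUT C ⇔ BoundedSize C
  cut⇔bounded = mk⇔ bounded cut
    where
    bounded : HasCUT C → BoundedSize C
    bounded (f , C-cut) = cutBound k f n , λ G G∈C → let H , D , D≤n , H≅G = C-wd G G∈C in
      ℕ.≤-trans (≅⇒≤ G (Del H) (≅-sym (Del H) G H≅G))
        (size≤cutBound D≤n λ K → cutLe-≅ G (Del H) (≅-sym (Del H) G H≅G) (C-cut G G∈C K))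
    cut : BoundedSize C → HasCUT C
    cut (N , C≤N) = (λ _ → N) , λ G G∈C K m R Hs nonempty p →
      ℕ.≤-trans (arity≤size G nonempty p) (C≤N G G∈C)

  outdeg⇔bounded : BoundedOutdeg n k C ⇔ BoundedSize C
  outdeg⇔bounded = mk⇔ bounded outdeg
    where
    bounded : BoundedOutdeg n k C → BoundedSize C
    bounded (d , C-deg) = degreeBound d n , λ G G∈C →
      let H , D , D≤n , D-deg , H≅G = C-deg G G∈C in
      ℕ.≤-trans (≅⇒≤ G (Del H) (≅-sym (Del H) G H≅G)) (size≤degreeBound D≤n D-deg)
    outdeg : BoundedSize C → BoundedOutdeg n k C
    outdeg (N , C≤N) = N , λ G G∈C → let H , D , D≤n , H≅G = C-wd G G∈C in
      H , D , D≤n , outdeg≤size D (ℕ.≤-trans (≅⇒≤ (Del H) G H≅G) (C≤N G G∈C)) , H≅G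

  orderable⇔bounded : MSO1Orderable C ⇔ BoundedSize C
  orderable⇔bounded = mk⇔ bounded orderable
    where
    bounded : MSO1Orderable C → BoundedSize C
    bounded (j , φ , C-ord) = rigidBound k (2 ^ j) n , λ G G∈C →
      let H , D , D≤n , H≅G = C-wd G G∈C
          f , f-adj = ≅-sym (Del H) G H≅G
          G≤H = ≅⇒≤ G (Del H) (f , f-adj)
          H≤G = ≅⇒≤ (Del H) G H≅G
          -- An order is provided for nonempty graphs only; having a decomposition ensures
          -- nonemptiness.
          P , order = C-ord G G∈C (ℕ.≤-trans (decomp-nonempty D) H≤G)
      in ℕ.≤-trans G≤H (size≤rigidBound D≤n _
           (rigid-transport f f-adj (order⇒rigid G φ P order)))
    orderable : BoundedSize C → MSO1Orderable C
    -- `N` depends on the class alone, so one formula orders all its graphs.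
    orderable (N , C≤N) = N , initialSegments N , λ G G∈C _ →
      segment G (C≤N G G∈C) , ≼-isTotalOrder G (C≤N G G∈C)

theorem5p23 : (C : Graph → Set) (n k : ℕ) → (∀ G → C G → WdLe n k G) →
    (MSO1Orderable C ⇔ HasCUT C) × (HasCUT C ⇔ BoundedOutdeg n k C) ×
    (BoundedOutdeg n k C ⇔ FiniteClass C)
theorem5p23 C n k C-wd =
    ⇔-sym cut ⇔-∘ orderable⇔bounded C n k C-wd
  , ⇔-sym outdeg ⇔-∘ cut
  , ⇔-sym (finite⇔bounded C) ⇔-∘ outdeg
  where
  cut : HasCUT C ⇔ BoundedSize C
  cut = cut⇔bounded C n k C-wd
  outdeg : BoundedOutdeg n k C ⇔ BoundedSize C
  outdeg = outdeg⇔bounded C n k C-wd
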